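{- Let $p$ be a prime and $N\ge1$ an integer with $p\nmid N$, and let $d,d^{\mathrm{new}}$ be as in the context. Then $d+d^{\mathrm{new}}$ is a non-decreasing function on $\mathbb Z$.
   Context: Let $\delta=p-1$ if $p$ is odd and $\delta=2$ if $p=2$. Let $\mu_0(N)$ be the index of $\Gamma_0(N)$ in $\mathrm{SL}_2(\mathbb Z)$, $c_0(N)$ the number of cusps of $X_0(N)$, $\mu_{0,2}(N)$ and $\mu_{0,3}(N)$ the numbers of elliptic points of order 2 and 3 on $X_0(N)$, and $\left(\frac{a}{b}\right)$ the Kronecker symbol. For $k\in\mathbb Z$ set $$D_k=\frac{(k-1)\mu_0(N)}{12}+\Bigl(\Bigl\lfloor\frac k4\Bigr\rfloor-\frac{k-1}4\Bigr)\mu_{0,2}(N)+\Bigl(\Bigl\lfloor\frac k3\Bigr\rfloor-\frac{k-1}3\Bigr)\mu_{0,3}(N)-\frac{c_0(N)}2,$$ $$D_k^{\mathrm{new}}=\frac{(k-1)(p-1)}{12}\mu_0(N)+\Bigl(\Bigl\lfloor\frac k4\Bigr\rfloor-\frac{k-1}4\Bigr)\Bigl(-1+\Bigl(\frac{ -4}{p}\Bigr)\Bigr)\mu_{0,2}(N)+\Bigl(\Bigl\lfloor\frac k3\Bigr\rfloor-\frac{k-1}3\Bigr)\Bigl(-1+\Bigl(\frac{ -3}{p}\Bigr)\Bigr)\mu_{0,3}(N)$$ (for even $k>2$ these equal $\dim S_k(\Gamma_0(N))$ and $\dim S_k(\Gamma_0(Np))^{p\text{ -new}}$). Fix an even integer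 $k_0$ with $2\le k_0<p+1$, set $k_n=k_0+n\delta$, $d(n)=D_{k_n}$ and $d^{\mathrm{new}}(n)=D^{\mathrm{new}}_{k_n}$. -}

module Defs where

open import Data.Bool using (Bool; true; false; if_then_else_; _∨_)
import Data.Nat as ℕ
open import Data.Nat using (ℕ; zero; suc)
open import Data.Nat.Divisibility using (_∣?_)
open import Data.Nat.Primality using (prime?)
open import Data.Nat.GCD using (gcd)
import Data.Integer as ℤ
open import Data.Integer using (ℤ; +_; -[1+_]; _%ℕ_)
open import Data.Rational using (ℚ; _/_)
import Data.Rational as ℚ
open import Data.List using (List; filter; foldr; upTo; applyUpTo; length; concatMap; map)
open import Data.Bool.ListAction using (any)
open import Relation.Nullary.Decidable using (⌊_⌋; _×-dec_)

primeDivisors : ℕ → List ℕ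
primeDivisors N = filter (λ q → prime? q ×-dec q ∣? N) (upTo (suc N))

prodℤ : List ℤ → ℤ
prodℤ = foldr ℤ._*_ (+ 1)

prodℚ : List ℚ → ℚ
prodℚ = foldr ℚ._*_ ℚ.1ℚ

sumℕ : List ℕ → ℕ
sumℕ = foldr ℕ._+_ 0

totient : ℕ → ℕ
totient m = length (filter (λ a → gcd a m ℕ.≟ 1) (applyUpTo suc m))

-- Kronecker symbol (a/q) for q a PRIME (the only case used here):
--   q = 2 : 0 if a even, 1 if a ≡ ±1 (mod 8), -1 if a ≡ ±3 (mod 8);
--   q odd : Legendre symbol: 0 if q ∣ a, 1 if a is a nonzero square mod q, -1 otherwise.
kronPrime : ℤ → ℕ → ℤ
kronPrime a zero = + 0
kronPrime a q@(suc q′) =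
  if ⌊ q ℕ.≟ 2 ⌋
  then (if ⌊ a %ℕ 8 ℕ.≟ 1 ⌋ ∨ ⌊ a %ℕ 8 ℕ.≟ 7 ⌋ then + 1
        else if ⌊ a %ℕ 8 ℕ.≟ 3 ⌋ ∨ ⌊ a %ℕ 8 ℕ.≟ 5 ⌋ then -[1+ 0 ]
        else + 0)
  else (if ⌊ a %ℕ q ℕ.≟ 0 ⌋ then + 0
        else if any (λ x → ⌊ (x ℕ.* x) ℕ.% q ℕ.≟ a %ℕ q ⌋) (upTo q) then + 1
        else -[1+ 0 ])

-- index of Γ₀(N) in SL₂(ℤ): N ∏_{q ∣ N} (1 + 1/q)
μ₀ : ℕ → ℚ
μ₀ N = (+ N / 1) ℚ.* prodℚ (map (λ q → (+ (suc q)) / suc (ℕ.pred q)) (primeDivisors N))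

-- number of cusps of X₀(N): Σ_{d e = N} φ(gcd(d,e))
c₀ : ℕ → ℕ
c₀ N = sumℕ (concatMap (λ d → map (λ e → if ⌊ d ℕ.* e ℕ.≟ N ⌋ then totient (gcd d e) else 0)
                                   (applyUpTo suc N))
                        (applyUpTo suc N))

-- number of elliptic points of order 2 on X₀(N)
μ₀₂ : ℕ → ℤ
μ₀₂ N = if ⌊ 4 ∣? N ⌋ then + 0
        else prodℤ (map (λ q → + 1 ℤ.+ kronPrime (ℤ.- (+ 4)) q) (primeDivisors N))

-- number of elliptic points of order 3 on X₀(N)
μ₀₃ : ℕ → ℤ
μ₀₃ N = if ⌊ 9 ∣? N ⌋ then + 0
        else prodℤ (map (λ q → + 1 ℤ.+ kronPrime (ℤ.- (+ 3)) q) (primeDivisors N))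

δ : ℕ → ℕ
δ p = if ⌊ p ℕ.≟ 2 ⌋ then 2 else p ℕ.∸ 1

corr : ℤ → ℕ → ℚ
corr k zero = ℚ.0ℚ
corr k m@(suc _) = (ℚ.floor (k / m) / 1) ℚ.- ((k ℤ.- + 1) / m)

D : ℕ → ℤ → ℚ
D N k = (((k ℤ.- + 1) / 12) ℚ.* μ₀ N)
        ℚ.+ (corr k 4 ℚ.* (μ₀₂ N / 1))
        ℚ.+ (corr k 3 ℚ.* (μ₀₃ N / 1))
        ℚ.- ((+ c₀ N) / 2)

Dnew : ℕ → ℕ → ℤ → ℚ
Dnew p N k = ((((k ℤ.- + 1) ℤ.* (+ p ℤ.- + 1)) / 12) ℚ.* μ₀ N)
        ℚ.+ (corr k 4 ℚ.* (((-[1+ 0 ] ℤ.+ kronPrime (ℤ.- (+ 4)) p) ℤ.* μ₀₂ N) / 1))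
        ℚ.+ (corr k 3 ℚ.* (((-[1+ 0 ] ℤ.+ kronPrime (ℤ.- (+ 3)) p) ℤ.* μ₀₃ N) / 1))

kₙ : ℕ → ℕ → ℤ → ℤ
kₙ p k₀ n = + k₀ ℤ.+ n ℤ.* + δ p

d : ℕ → ℕ → ℕ → ℤ → ℚ
d p N k₀ n = D N (kₙ p k₀ n)

dnew : ℕ → ℕ → ℕ → ℤ → ℚ
dnew p N k₀ n = Dnew p N (kₙ p k₀ n)

{-# OPTIONS --safe #-}
-- Write S k = D_k + D_k^new. Since ⌊k/m⌋ - (k-1)/m = (1 - k mod m)/m, collecting terms gives
--   12 S k + 6 c₀ = (k-1) p μ₀ + 3 (1 - k mod 4) χ₄ μ₀₂ + 4 (1 - k mod 3) χ₃ μ₀₃,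
-- with χ₄ = (-4/p) and χ₃ = (-3/p). Hence 12 (S (k + δ) - S k) = δ p μ₀ + 3 g₄ χ₄ μ₀₂ + 4 g₃ χ₃ μ₀₃,
-- where g_m = k mod m - (k + δ) mod m lies in [1 - m, m - 1]. The elliptic counts μ₀₂, μ₀₃ are
-- products of factors 1 + (a/q) ≤ 2 ≤ q + 1 over the primes q ∣ N, so 0 ≤ μ₀₂, μ₀₃ ≤ μ₀; thus the
-- increment is nonnegative once δ · p ≥ 9 + 8, i.e. for p ≥ 5. For p = 2 and p = 3 one of χ₄, χ₃
-- vanishes, and δ = 2 while a shift by 2 never lowers a residue mod m by m - 1.
module Submission where

open import Defs
open import Data.Bool using (true; false; if_then_else_; _∨_)
open import Data.Bool.ListAction using (any)
open import Data.Integer as ℤ using (ℤ; +_; -[1+_]; +≤+)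
open import Data.Integer.DivMod using (a≡a%n+[a/n]*n; n%d<d)
import Data.Integer.Properties as ℤP
open import Data.Integer.Tactic.RingSolver as ℤ-Solver using ()
open import Data.List using ([]; _∷_; map; upTo)
open import Data.List.Relation.Unary.All as All using (All; []; _∷_)
import Data.List.Relation.Unary.All.Properties as All
open import Data.List.Relation.Unary.AllPairs as AllPairs using (AllPairs; []; _∷_)
import Data.List.Relation.Unary.AllPairs.Properties as AllPairs
open import Data.Nat as ℕ using (ℕ; suc; zero)
open import Data.Nat.Divisibility using (_∣_; _∣?_; divides; 1∣_; ∣⇒≤; *-monoʳ-∣; ∣m+n∣m⇒∣n; ∣-refl; ∣1⇒≡1)
open import Data.Nat.GCD using (gcd)
open import Data.Nat.ListAction using (product)
open import Data.Nat.Primality using (Prime; prime?; euclidsLemma; prime⇒nonZero; ¬prime[0]; ¬prime[1]; prime⇒¬composite; composite[4])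
import Data.Nat.Properties as ℕP
open import Data.Product using (_×_; _,_; proj₁; proj₂; ∃-syntax)
open import Data.Rational as ℚ using (ℚ; _/_)
import Data.Rational.Properties as ℚP
open import Data.Rational.Unnormalised as ℚᵘ using (mkℚᵘ; *≡*; *≤*)
import Data.Rational.Unnormalised.Properties as ℚᵘP
open import Data.Sum using (inj₁; inj₂)
open import Level using (0ℓ)
open import Relation.Binary.PropositionalEquality
open import Relation.Nullary using (¬_; contradiction)
open import Relation.Nullary.Decidable using (_×-dec_; ⌊_⌋; dec⇒maybe)
open import Tactic.RingSolver as RingSolver using ()
open import Tactic.RingSolver.Core.AlmostCommutativeRing using (AlmostCommutativeRing; fromCommutativeRing)

ℚ-ring : AlmostCommutativeRing 0ℓ 0ℓ
ℚ-ring = fromCommutativeRing ℚP.+-*-commutativeRing (λ x → dec⇒maybe (ℚ.0ℚ ℚP.≟ x))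

ι : ℤ → ℚ
ι i = i / 1

toℚᵘ-/ : ∀ i n → ℚ.toℚᵘ (i / suc n) ℚᵘ.≃ mkℚᵘ i n
toℚᵘ-/ i n = ℚP.toℚᵘ-fromℚᵘ (mkℚᵘ i n)

ι-+ : ∀ i j → ι (i ℤ.+ j) ≡ ι i ℚ.+ ι j
ι-+ i j = ℚP.toℚᵘ-injective (begin
  ℚ.toℚᵘ (ι (i ℤ.+ j))            ≈⟨ toℚᵘ-/ (i ℤ.+ j) 0 ⟩
  mkℚᵘ (i ℤ.+ j) 0                ≈⟨ *≡* (eq i j) ⟩
  mkℚᵘ i 0 ℚᵘ.+ mkℚᵘ j 0          ≈⟨ ℚᵘP.+-cong (toℚᵘ-/ i 0) (toℚᵘ-/ j 0) ⟨
  ℚ.toℚᵘ (ι i) ℚᵘ.+ ℚ.toℚᵘ (ι j)  ≈⟨ ℚP.toℚᵘ-homo-+ (ι i) (ι j) ⟨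
  ℚ.toℚᵘ (ι i ℚ.+ ι j)            ∎)
  where
  open ℚᵘP.≃-Reasoning
  eq : ∀ i j → (i ℤ.+ j) ℤ.* + 1 ≡ (i ℤ.* + 1 ℤ.+ j ℤ.* + 1) ℤ.* + 1
  eq = ℤ-Solver.solve-∀

ι-* : ∀ i j → ι (i ℤ.* j) ≡ ι i ℚ.* ι j
ι-* i j = ℚP.toℚᵘ-injective (begin
  ℚ.toℚᵘ (ι (i ℤ.* j))            ≈⟨ toℚᵘ-/ (i ℤ.* j) 0 ⟩
  mkℚᵘ (i ℤ.* j) 0                ≈⟨ ℚᵘP.*-cong (toℚᵘ-/ i 0) (toℚᵘ-/ j 0) ⟨
  ℚ.toℚᵘ (ι i) ℚᵘ.* ℚ.toℚᵘ (ι j)  ≈⟨ ℚP.toℚᵘ-homo-* (ι i) (ι j) ⟨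
  ℚ.toℚᵘ (ι i ℚ.* ι j)            ∎)
  where open ℚᵘP.≃-Reasoning

ι-neg : ∀ i → ι (ℤ.- i) ≡ ℚ.- ι i
ι-neg i = ℚP.toℚᵘ-injective (begin
  ℚ.toℚᵘ (ι (ℤ.- i))  ≈⟨ toℚᵘ-/ (ℤ.- i) 0 ⟩
  mkℚᵘ (ℤ.- i) 0      ≈⟨ ℚᵘP.-‿cong (toℚᵘ-/ i 0) ⟨
  ℚᵘ.- ℚ.toℚᵘ (ι i)   ≈⟨ ℚP.toℚᵘ-homo‿- (ι i) ⟨
  ℚ.toℚᵘ (ℚ.- ι i)    ∎)
  where open ℚᵘP.≃-Reasoning

ι-- : ∀ i j → ι (i ℤ.- j) ≡ ι i ℚ.- ι j
ι-- i j = trans (ι-+ i (ℤ.- j)) (cong (ι i ℚ.+_) (ι-neg j))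

ι-mono-≤ : ∀ {i j} → i ℤ.≤ j → ι i ℚ.≤ ι j
ι-mono-≤ {i} {j} i≤j = ℚP.toℚᵘ-cancel-≤ (ℚᵘP.≤-respˡ-≃ (ℚᵘP.≃-sym (toℚᵘ-/ i 0))
  (ℚᵘP.≤-respʳ-≃ (ℚᵘP.≃-sym (toℚᵘ-/ j 0)) (*≤* (ℤP.*-monoʳ-≤-nonNeg (+ 1) i≤j))))

i/n≡ι[i]*1/n : ∀ i n → i / suc n ≡ ι i ℚ.* (+ 1 / suc n)
i/n≡ι[i]*1/n i n = ℚP.toℚᵘ-injective (begin
  ℚ.toℚᵘ (i / suc n)                          ≈⟨ toℚᵘ-/ i n ⟩
  mkℚᵘ i n                                    ≈⟨ *≡* (eq i (+ suc n)) ⟩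
  mkℚᵘ i 0 ℚᵘ.* mkℚᵘ (+ 1) n                  ≈⟨ ℚᵘP.*-cong (toℚᵘ-/ i 0) (toℚᵘ-/ (+ 1) n) ⟨
  ℚ.toℚᵘ (ι i) ℚᵘ.* ℚ.toℚᵘ (+ 1 / suc n)      ≈⟨ ℚP.toℚᵘ-homo-* (ι i) _ ⟨
  ℚ.toℚᵘ (ι i ℚ.* (+ 1 / suc n))              ∎)
  where
  open ℚᵘP.≃-Reasoning
  eq : ∀ i d → i ℤ.* (+ 1 ℤ.* d) ≡ (i ℤ.* + 1) ℤ.* d
  eq = ℤ-Solver.solve-∀

ι[n]*1/n≡1 : ∀ n → ι (+ suc n) ℚ.* (+ 1 / suc n) ≡ ℚ.1ℚ
ι[n]*1/n≡1 n = trans (sym (i/n≡ι[i]*1/n (+ suc n) n))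
  (ℚP.toℚᵘ-injective (ℚᵘP.≃-trans (toℚᵘ-/ (+ suc n) n) (*≡* (ℤP.*-comm (+ suc n) (+ 1)))))

-- The record pattern lets ℚ.floor q unfold to ↥ q / ↧ q.
↥≡%+floor*↧ : ∀ q → ℚ.numerator q ≡ + (ℚ.numerator q ℤ.% ℚ.denominator q) ℤ.+ ℚ.floor q ℤ.* ℚ.denominator q
↥≡%+floor*↧ q@record{} = a≡a%n+[a/n]*n (ℚ.numerator q) (ℚ.denominator q)

rem : ℤ → (m : ℕ) → .{{ℕ.NonZero m}} → ℤ
rem k m = k ℤ.- ℚ.floor (k / m) ℤ.* + m

rem-bounded : ∀ k m .{{_ : ℕ.NonZero m}} → ∃[ r ] r ℕ.< m × rem k m ≡ + r
rem-bounded k m = ρ ℕ.* g , ρg<m , rem≡ρg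
  where
  q = k / m
  g = gcd ℤ.∣ k ∣ m
  ρ = ℚ.numerator q ℤ.% ℚ.denominator q
  ↧q*g≡m : ℚ.denominatorℕ q ℕ.* g ≡ m
  ↧q*g≡m = ℤP.+-injective (trans (ℤP.pos-* (ℚ.denominatorℕ q) g) (ℚP.↧-/ k m))
  instance
    g≢0 : ℕ.NonZero g
    g≢0 = ℕ.≢-nonZero λ g≡0 → ℕ.≢-nonZero⁻¹ m (trans (sym ↧q*g≡m) (trans (cong (ℚ.denominatorℕ q ℕ.*_) g≡0) (ℕP.*-zeroʳ (ℚ.denominatorℕ q))))
  ρg<m : ρ ℕ.* g ℕ.< m
  ρg<m = subst (ρ ℕ.* g ℕ.<_) ↧q*g≡m (ℕP.*-monoˡ-< g (n%d<d (ℚ.numerator q) (ℚ.denominator q)))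
  rem≡ρg : rem k m ≡ + (ρ ℕ.* g)
  rem≡ρg = begin
    k ℤ.- ℚ.floor q ℤ.* + m
      ≡⟨ cong₂ (λ a b → a ℤ.- ℚ.floor q ℤ.* b) (sym (ℚP.↥-/ k m)) (sym (ℚP.↧-/ k m)) ⟩
    ℚ.numerator q ℤ.* + g ℤ.- ℚ.floor q ℤ.* (ℚ.denominator q ℤ.* + g)
      ≡⟨ cong (λ a → a ℤ.* + g ℤ.- ℚ.floor q ℤ.* (ℚ.denominator q ℤ.* + g)) (↥≡%+floor*↧ q) ⟩
    (+ ρ ℤ.+ ℚ.floor q ℤ.* ℚ.denominator q) ℤ.* + g ℤ.- ℚ.floor q ℤ.* (ℚ.denominator q ℤ.* + g)
      ≡⟨ cancel (+ ρ) (ℚ.floor q) (ℚ.denominator q) (+ g) ⟩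
    + ρ ℤ.* + g
      ≡⟨ ℤP.pos-* ρ g ⟨
    + (ρ ℕ.* g) ∎
    where
    open ≡-Reasoning
    cancel : ∀ r f d g → (r ℤ.+ f ℤ.* d) ℤ.* g ℤ.- f ℤ.* (d ℤ.* g) ≡ r ℤ.* g
    cancel = ℤ-Solver.solve-∀

corr≡ι[1-rem]*1/m : ∀ k m → corr k (suc m) ≡ ι (+ 1 ℤ.- rem k (suc m)) ℚ.* (+ 1 / suc m)
corr≡ι[1-rem]*1/m k m = begin
  ι f ℚ.- (k ℤ.- + 1) / suc m                        ≡⟨ cong (λ x → ι f ℚ.- x) (i/n≡ι[i]*1/n (k ℤ.- + 1) m) ⟩
  ι f ℚ.- ι (k ℤ.- + 1) ℚ.* c                        ≡⟨ cong (λ x → ι f ℚ.- x ℚ.* c) (ι-- k (+ 1)) ⟩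
  ι f ℚ.- (ι k ℚ.- ℚ.1ℚ) ℚ.* c                       ≡⟨ cong (λ x → x ℚ.- (ι k ℚ.- ℚ.1ℚ) ℚ.* c) (ℚP.*-identityʳ (ι f)) ⟨
  ι f ℚ.* ℚ.1ℚ ℚ.- (ι k ℚ.- ℚ.1ℚ) ℚ.* c              ≡⟨ cong (λ x → ι f ℚ.* x ℚ.- (ι k ℚ.- ℚ.1ℚ) ℚ.* c) (ι[n]*1/n≡1 m) ⟨
  ι f ℚ.* (ι n ℚ.* c) ℚ.- (ι k ℚ.- ℚ.1ℚ) ℚ.* c       ≡⟨ regroup (ι f) (ι k) (ι n) c ⟩
  (ℚ.1ℚ ℚ.- (ι k ℚ.- ι f ℚ.* ι n)) ℚ.* c             ≡⟨ cong (λ x → (ℚ.1ℚ ℚ.- (ι k ℚ.- x)) ℚ.* c) (ι-* f n) ⟨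
  (ℚ.1ℚ ℚ.- (ι k ℚ.- ι (f ℤ.* n))) ℚ.* c             ≡⟨ cong (λ x → (ℚ.1ℚ ℚ.- x) ℚ.* c) (ι-- k (f ℤ.* n)) ⟨
  (ℚ.1ℚ ℚ.- ι (k ℤ.- f ℤ.* n)) ℚ.* c                 ≡⟨ cong (ℚ._* c) (ι-- (+ 1) (k ℤ.- f ℤ.* n)) ⟨
  ι (+ 1 ℤ.- rem k (suc m)) ℚ.* c                    ∎
  where
  open ≡-Reasoning
  f = ℚ.floor (k / suc m)
  n = + suc m
  c = + 1 / suc m
  regroup : ∀ f k n c → f ℚ.* (n ℚ.* c) ℚ.- (k ℚ.- ℚ.1ℚ) ℚ.* c ≡ (ℚ.1ℚ ℚ.- (k ℚ.- f ℚ.* n)) ℚ.* c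
  regroup = RingSolver.solve-∀ ℚ-ring

remDrop : ℤ → ℤ → (m : ℕ) → .{{ℕ.NonZero m}} → ℤ
remDrop k t m = rem k m ℤ.- rem (k ℤ.+ t) m

remDrop+t≡Δfloor*m : ∀ k t m .{{_ : ℕ.NonZero m}} →
  remDrop k t m ℤ.+ t ≡ (ℚ.floor ((k ℤ.+ t) / m) ℤ.- ℚ.floor (k / m)) ℤ.* + m
remDrop+t≡Δfloor*m k t m = shift k t (ℚ.floor (k / m)) (ℚ.floor ((k ℤ.+ t) / m)) (+ m)
  where
  shift : ∀ k t f f′ n → (k ℤ.- f ℤ.* n) ℤ.- ((k ℤ.+ t) ℤ.- f′ ℤ.* n) ℤ.+ t ≡ (f′ ℤ.- f) ℤ.* n
  shift = ℤ-Solver.solve-∀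

-m≤r-r′≤m : ∀ {r r′ m} → r ℕ.≤ m → r′ ℕ.≤ m → ℤ.- + m ℤ.≤ + r ℤ.- + r′ × + r ℤ.- + r′ ℤ.≤ + m
-m≤r-r′≤m {r} {r′} {m} r≤m r′≤m =
  subst (ℤ._≤ + r ℤ.- + r′) (ℤP.+-identityˡ (ℤ.- + m)) (ℤP.+-mono-≤ (+≤+ ℕ.z≤n) (ℤP.neg-mono-≤ (+≤+ r′≤m))) ,
  subst (+ r ℤ.- + r′ ℤ.≤_) (ℤP.+-identityʳ (+ m)) (ℤP.+-mono-≤ (+≤+ r≤m) (ℤP.neg-mono-≤ (+≤+ (ℕ.z≤n {r′}))))

remDrop-bounds : ∀ k t m → ℤ.- + m ℤ.≤ remDrop k t (suc m) × remDrop k t (suc m) ℤ.≤ + m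
remDrop-bounds k t m with rem-bounded k (suc m) | rem-bounded (k ℤ.+ t) (suc m)
... | r , r<m , rem≡r | r′ , r′<m , rem′≡r′ rewrite rem≡r | rem′≡r′ = -m≤r-r′≤m (ℕ.s≤s⁻¹ r<m) (ℕ.s≤s⁻¹ r′<m)

-- A drop of 1 + m would make 2 + m divide 3 + m.
remDrop[2]≤ : ∀ k m → remDrop k (+ 2) (2 ℕ.+ m) ℤ.≤ + m
remDrop[2]≤ k m = ℤP.i<j⇒i≤pred[j] (ℤP.≤∧≢⇒< (proj₂ (remDrop-bounds k (+ 2) (suc m))) drop≢)
  where
  n = 2 ℕ.+ m
  Δfloor = ℚ.floor ((k ℤ.+ + 2) / n) ℤ.- ℚ.floor (k / n)
  drop≢ : remDrop k (+ 2) n ≢ + suc m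
  drop≢ drop≡ = contradiction (∣1⇒≡1 (∣m+n∣m⇒∣n (divides ℤ.∣ Δfloor ∣ n+1≡) (∣-refl {n}))) λ ()
    where
    n+1≡ : n ℕ.+ 1 ≡ ℤ.∣ Δfloor ∣ ℕ.* n
    n+1≡ = begin
      n ℕ.+ 1                           ≡⟨ cong suc (ℕP.+-suc m 1) ⟨
      ℤ.∣ + suc m ℤ.+ + 2 ∣              ≡⟨ cong (λ x → ℤ.∣ x ℤ.+ + 2 ∣) drop≡ ⟨
      ℤ.∣ remDrop k (+ 2) n ℤ.+ + 2 ∣    ≡⟨ cong ℤ.∣_∣ (remDrop+t≡Δfloor*m k (+ 2) n) ⟩
      ℤ.∣ Δfloor ℤ.* + n ∣               ≡⟨ ℤP.abs-* Δfloor (+ n) ⟩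
      ℤ.∣ Δfloor ∣ ℕ.* n                 ∎
      where open ≡-Reasoning

if-elim : ∀ {a ℓ} {A : Set a} (P : A → Set ℓ) b {x y} → P x → P y → P (if b then x else y)
if-elim P true  px py = px
if-elim P false px py = py

data SignValue : ℤ → Set where
  zero     : SignValue (+ 0)
  one      : SignValue (+ 1)
  minusOne : SignValue -[1+ 0 ]

kronPrime-signValue : ∀ a q → SignValue (kronPrime a q)
kronPrime-signValue a zero    = zero
kronPrime-signValue a (suc q) with ⌊ suc q ℕ.≟ 2 ⌋
... | true with ⌊ a ℤ.%ℕ 8 ℕ.≟ 1 ⌋ ∨ ⌊ a ℤ.%ℕ 8 ℕ.≟ 7 ⌋
...   | true  = one
...   | false with ⌊ a ℤ.%ℕ 8 ℕ.≟ 3 ⌋ ∨ ⌊ a ℤ.%ℕ 8 ℕ.≟ 5 ⌋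
...     | true  = minusOne
...     | false = zero
kronPrime-signValue a (suc q) | false with ⌊ a ℤ.%ℕ suc q ℕ.≟ 0 ⌋
...   | true  = zero
...   | false with any (λ x → ⌊ (x ℕ.* x) ℕ.% suc q ℕ.≟ a ℤ.%ℕ suc q ⌋) (upTo (suc q))
...     | true  = one
...     | false = minusOne

1+signValue-bounds : ∀ {K} → SignValue K → + 0 ℤ.≤ + 1 ℤ.+ K × + 1 ℤ.+ K ℤ.≤ + 2
1+signValue-bounds zero     = +≤+ ℕ.z≤n , +≤+ (ℕ.s≤s ℕ.z≤n)
1+signValue-bounds one      = +≤+ ℕ.z≤n , ℤP.≤-refl
1+signValue-bounds minusOne = +≤+ ℕ.z≤n , +≤+ ℕ.z≤n

∣-cofactor : ∀ {r q m} → Prime r → Prime q → q ℕ.< r → r ∣ m ℕ.* q → r ∣ m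
∣-cofactor {q = q} {m} r-prime q-prime q<r r∣mq with euclidsLemma m q r-prime r∣mq
... | inj₁ r∣m = r∣m
... | inj₂ r∣q = contradiction (∣⇒≤ {{prime⇒nonZero q-prime}} r∣q) (ℕP.<⇒≱ q<r)

product-∣ : ∀ {m} L → AllPairs ℕ._<_ L → All (λ q → Prime q × q ∣ m) L → product L ∣ m
product-∣ {m} [] _ _ = 1∣ m
product-∣ (q ∷ L) (q<L ∷ sorted) ((q-prime , divides m′ m≡m′q) ∷ divs) =
  subst (q ℕ.* product L ∣_) (trans (ℕP.*-comm q m′) (sym m≡m′q))
    (*-monoʳ-∣ q (product-∣ L sorted (All.zipWith cofactor (q<L , divs))))
  where
  cofactor : ∀ {r} → q ℕ.< r × (Prime r × r ∣ _) → Prime r × r ∣ m′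
  cofactor (q<r , r-prime , r∣m) = r-prime , ∣-cofactor r-prime q-prime q<r (subst (_ ∣_) m≡m′q r∣m)

primeDivisors-sorted : ∀ N → AllPairs ℕ._<_ (primeDivisors N)
primeDivisors-sorted N = AllPairs.filter⁺ (λ q → prime? q ×-dec q ∣? N) (AllPairs.applyUpTo⁺₁ (λ i → i) (suc N) (λ i<j _ → i<j))

primeDivisors-prime-∣ : ∀ N → All (λ q → Prime q × q ∣ N) (primeDivisors N)
primeDivisors-prime-∣ N = All.all-filter (λ q → prime? q ×-dec q ∣? N) (upTo (suc N))

product-primeDivisors-≤ : ∀ N → 1 ℕ.≤ N → product (primeDivisors N) ℕ.≤ N
product-primeDivisors-≤ N@(suc _) _ = ∣⇒≤ (product-∣ _ (primeDivisors-sorted N) (primeDivisors-prime-∣ N))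

prodℤ-nonNeg : ∀ {g : ℕ → ℤ} → (∀ q → + 0 ℤ.≤ g q) → ∀ L → + 0 ℤ.≤ prodℤ (map g L)
prodℤ-nonNeg g≥0 []      = +≤+ ℕ.z≤n
prodℤ-nonNeg g≥0 (q ∷ L) = ℤP.*-monoʳ-≤-nonNeg _ {{ℤ.nonNegative (prodℤ-nonNeg g≥0 L)}} (g≥0 q)

prodℤ-mono-≤ : ∀ {g h : ℕ → ℤ} → (∀ q → + 0 ℤ.≤ g q) → ∀ L → All (λ q → g q ℤ.≤ h q) L →
  prodℤ (map g L) ℤ.≤ prodℤ (map h L)
prodℤ-mono-≤ g≥0 []      []             = ℤP.≤-refl
prodℤ-mono-≤ {g} {h} g≥0 (q ∷ L) (gq≤hq ∷ g≤h) = begin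
  g q ℤ.* prodℤ (map g L) ≤⟨ ℤP.*-monoʳ-≤-nonNeg _ {{ℤ.nonNegative (prodℤ-nonNeg g≥0 L)}} gq≤hq ⟩
  h q ℤ.* prodℤ (map g L) ≤⟨ ℤP.*-monoˡ-≤-nonNeg _ {{ℤ.nonNegative (ℤP.≤-trans (g≥0 q) gq≤hq)}} (prodℤ-mono-≤ g≥0 L g≤h) ⟩
  h q ℤ.* prodℤ (map h L) ∎
  where open ℤP.≤-Reasoning

-- The factor 1 + 1/q of μ₀, written as in Defs.μ₀ so that μ₀ N is ι (+ N) times their product.
indexFactor : ℕ → ℚ
indexFactor q = + suc q / suc (ℕ.pred q)

0≤* : ∀ {p q} → ℚ.0ℚ ℚ.≤ p → ℚ.0ℚ ℚ.≤ q → ℚ.0ℚ ℚ.≤ p ℚ.* q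
0≤* {p} {q} 0≤p 0≤q = ℚP.nonNegative⁻¹ _ {{ℚP.nonNeg*nonNeg⇒nonNeg p {{ℚ.nonNegative 0≤p}} q {{ℚ.nonNegative 0≤q}}}}

prodℚ-indexFactor-nonNeg : ∀ L → ℚ.0ℚ ℚ.≤ prodℚ (map indexFactor L)
prodℚ-indexFactor-nonNeg []      = ℚ.*≤* (+≤+ ℕ.z≤n)
prodℚ-indexFactor-nonNeg (q ∷ L) =
  0≤* {indexFactor q} (ℚP.nonNegative⁻¹ _ {{ℚP.normalize-nonNeg (suc q) (suc (ℕ.pred q))}}) (prodℚ-indexFactor-nonNeg L)

ι-prod-suc : ∀ L → All (1 ℕ.≤_) L →
  ι (prodℤ (map (λ q → + suc q) L)) ≡ ι (+ product L) ℚ.* prodℚ (map indexFactor L)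
ι-prod-suc []                  []       = refl
ι-prod-suc (suc q ∷ L) (_ ∷ 1≤L) = begin
  ι (+ suc (suc q) ℤ.* prodℤ (map (λ q → + suc q) L))   ≡⟨ ι-* (+ suc (suc q)) (prodℤ (map (λ q → + suc q) L)) ⟩
  ι (+ suc (suc q)) ℚ.* ι (prodℤ (map (λ q → + suc q) L)) ≡⟨ cong₂ ℚ._*_ ι-suc (ι-prod-suc L 1≤L) ⟩
  (ι (+ suc q) ℚ.* indexFactor (suc q)) ℚ.* (ι (+ product L) ℚ.* P)
    ≡⟨ interchange (ι (+ suc q)) (indexFactor (suc q)) (ι (+ product L)) P ⟩
  (ι (+ suc q) ℚ.* ι (+ product L)) ℚ.* (indexFactor (suc q) ℚ.* P)
    ≡⟨ cong (ℚ._* (indexFactor (suc q) ℚ.* P)) (trans (cong ι (ℤP.pos-* (suc q) (product L))) (ι-* (+ suc q) (+ product L))) ⟨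
  ι (+ (suc q ℕ.* product L)) ℚ.* (indexFactor (suc q) ℚ.* P) ∎
  where
  open ≡-Reasoning
  P = prodℚ (map indexFactor L)
  ι-suc : ι (+ suc (suc q)) ≡ ι (+ suc q) ℚ.* indexFactor (suc q)
  ι-suc = begin
    ι (+ suc (suc q))                              ≡⟨ ℚP.*-identityʳ _ ⟨
    ι (+ suc (suc q)) ℚ.* ℚ.1ℚ                     ≡⟨ cong (ι (+ suc (suc q)) ℚ.*_) (ι[n]*1/n≡1 q) ⟨
    ι (+ suc (suc q)) ℚ.* (ι (+ suc q) ℚ.* c)      ≡⟨ swap (ι (+ suc (suc q))) (ι (+ suc q)) c ⟩
    ι (+ suc q) ℚ.* (ι (+ suc (suc q)) ℚ.* c)      ≡⟨ cong (ι (+ suc q) ℚ.*_) (i/n≡ι[i]*1/n (+ suc (suc q)) q) ⟨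
    ι (+ suc q) ℚ.* indexFactor (suc q)            ∎
    where
    c = + 1 / suc q
    swap : ∀ a b c → a ℚ.* (b ℚ.* c) ≡ b ℚ.* (a ℚ.* c)
    swap = RingSolver.solve-∀ ℚ-ring
  interchange : ∀ a b c d → (a ℚ.* b) ℚ.* (c ℚ.* d) ≡ (a ℚ.* c) ℚ.* (b ℚ.* d)
  interchange = RingSolver.solve-∀ ℚ-ring

μ₀-nonNeg : ∀ N → ℚ.0ℚ ℚ.≤ μ₀ N
μ₀-nonNeg N = 0≤* (ι-mono-≤ (+≤+ (ℕ.z≤n {N}))) (prodℚ-indexFactor-nonNeg (primeDivisors N))

prodℤ-≤-μ₀ : ∀ N → 1 ℕ.≤ N → ∀ {g : ℕ → ℤ} → (∀ q → + 0 ℤ.≤ g q) → (∀ q → g q ℤ.≤ + 2) →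
  ι (prodℤ (map g (primeDivisors N))) ℚ.≤ μ₀ N
prodℤ-≤-μ₀ N 1≤N {g} g≥0 g≤2 = begin
  ι (prodℤ (map g L))                  ≤⟨ ι-mono-≤ (prodℤ-mono-≤ g≥0 L (All.map (λ {q} 1≤q → ℤP.≤-trans (g≤2 q) (+≤+ (ℕ.s≤s 1≤q))) 1≤L)) ⟩
  ι (prodℤ (map (λ q → + suc q) L))    ≡⟨ ι-prod-suc L 1≤L ⟩
  ι (+ product L) ℚ.* P                ≤⟨ ℚP.*-monoʳ-≤-nonNeg P {{ℚ.nonNegative (prodℚ-indexFactor-nonNeg L)}}
                                            (ι-mono-≤ (+≤+ (product-primeDivisors-≤ N 1≤N))) ⟩
  ι (+ N) ℚ.* P                        ∎
  where
  open ℚP.≤-Reasoning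
  L = primeDivisors N
  P = prodℚ (map indexFactor L)
  1≤L : All (1 ℕ.≤_) L
  1≤L = All.map (λ (q-prime , _) → ℕ.>-nonZero⁻¹ _ {{prime⇒nonZero q-prime}}) (primeDivisors-prime-∣ N)

ellipticCount-bounds : ∀ N → 1 ℕ.≤ N → ∀ a b →
  let z = if b then + 0 else prodℤ (map (λ q → + 1 ℤ.+ kronPrime a q) (primeDivisors N))
  in ℚ.0ℚ ℚ.≤ ι z × ι z ℚ.≤ μ₀ N
ellipticCount-bounds N 1≤N a b = if-elim (λ z → ℚ.0ℚ ℚ.≤ ι z × ι z ℚ.≤ μ₀ N) b
  (ℚP.≤-refl , μ₀-nonNeg N)
  (ι-mono-≤ (prodℤ-nonNeg g≥0 (primeDivisors N)) , prodℤ-≤-μ₀ N 1≤N g≥0 g≤2)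
  where
  g≥0 = λ q → proj₁ (1+signValue-bounds (kronPrime-signValue a q))
  g≤2 = λ q → proj₂ (1+signValue-bounds (kronPrime-signValue a q))

μ₀₂-bounds : ∀ N → 1 ℕ.≤ N → ℚ.0ℚ ℚ.≤ ι (μ₀₂ N) × ι (μ₀₂ N) ℚ.≤ μ₀ N
μ₀₂-bounds N 1≤N = ellipticCount-bounds N 1≤N (ℤ.- + 4) ⌊ 4 ∣? N ⌋

μ₀₃-bounds : ∀ N → 1 ℕ.≤ N → ℚ.0ℚ ℚ.≤ ι (μ₀₃ N) × ι (μ₀₃ N) ℚ.≤ μ₀ N
μ₀₃-bounds N 1≤N = ellipticCount-bounds N 1≤N (ℤ.- + 3) ⌊ 9 ∣? N ⌋

χ₄ χ₃ : ℕ → ℤ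
χ₄ p = kronPrime (ℤ.- (+ 4)) p
χ₃ p = kronPrime (ℤ.- (+ 3)) p

μ-combination : ℕ → ℤ → ℤ → ℤ → ℚ
μ-combination N x y z = ι x ℚ.* μ₀ N ℚ.+ ι y ℚ.* ι (μ₀₂ N) ℚ.+ ι z ℚ.* ι (μ₀₃ N)

D+Dnew≡μ-combination : ∀ p N k → D N k ℚ.+ Dnew p N k ≡
  μ-combination N ((k ℤ.- + 1) ℤ.* + p) (+ 3 ℤ.* ((+ 1 ℤ.- rem k 4) ℤ.* χ₄ p)) (+ 4 ℤ.* ((+ 1 ℤ.- rem k 3) ℤ.* χ₃ p))
    ℚ.* (+ 1 / 12) ℚ.- (+ c₀ N) / 2
D+Dnew≡μ-combination p N k = begin
  D N k ℚ.+ Dnew p N k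
    ≡⟨ substitute (i/n≡ι[i]*1/n (k ℤ.- + 1) 11) (corr≡ι[1-rem]*1/m k 3) (corr≡ι[1-rem]*1/m k 2)
                  new-coefficient (twisted (χ₄ p) (μ₀₂ N)) (twisted (χ₃ p) (μ₀₃ N)) ⟩
  (u ℚ.* c₁₂ ℚ.* M ℚ.+ a₄ ℚ.* c₄ ℚ.* x ℚ.+ a₃ ℚ.* c₃ ℚ.* y ℚ.- C)
    ℚ.+ (u ℚ.* (P ℚ.- ℚ.1ℚ) ℚ.* c₁₂ ℚ.* M ℚ.+ a₄ ℚ.* c₄ ℚ.* ((ι -[1+ 0 ] ℚ.+ K₄) ℚ.* x) ℚ.+ a₃ ℚ.* c₃ ℚ.* ((ι -[1+ 0 ] ℚ.+ K₃) ℚ.* y))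
    ≡⟨ collect u P a₄ a₃ K₄ K₃ M x y C ⟩
  (u ℚ.* P ℚ.* M ℚ.+ ι (+ 3) ℚ.* (a₄ ℚ.* K₄) ℚ.* x ℚ.+ ι (+ 4) ℚ.* (a₃ ℚ.* K₃) ℚ.* y) ℚ.* c₁₂ ℚ.- C
    ≡⟨ cong (λ w → w ℚ.* c₁₂ ℚ.- C) combination-in-atoms ⟨
  μ-combination N ((k ℤ.- + 1) ℤ.* + p) (+ 3 ℤ.* ((+ 1 ℤ.- rem k 4) ℤ.* χ₄ p)) (+ 4 ℤ.* ((+ 1 ℤ.- rem k 3) ℤ.* χ₃ p))
    ℚ.* c₁₂ ℚ.- C ∎
  where
  open ≡-Reasoning
  c₁₂ = + 1 / 12
  c₄ = + 1 / 4
  c₃ = + 1 / 3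
  u = ι (k ℤ.- + 1)
  P = ι (+ p)
  a₄ = ι (+ 1 ℤ.- rem k 4)
  a₃ = ι (+ 1 ℤ.- rem k 3)
  K₄ = ι (χ₄ p)
  K₃ = ι (χ₃ p)
  M = μ₀ N
  x = ι (μ₀₂ N)
  y = ι (μ₀₃ N)
  C = (+ c₀ N) / 2
  new-coefficient : ((k ℤ.- + 1) ℤ.* (+ p ℤ.- + 1)) / 12 ≡ u ℚ.* (P ℚ.- ℚ.1ℚ) ℚ.* c₁₂
  new-coefficient = trans (i/n≡ι[i]*1/n ((k ℤ.- + 1) ℤ.* (+ p ℤ.- + 1)) 11)
    (cong (ℚ._* c₁₂) (trans (ι-* (k ℤ.- + 1) (+ p ℤ.- + 1)) (cong (u ℚ.*_) (ι-- (+ p) (+ 1)))))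
  twisted : ∀ χ μ → ι ((-[1+ 0 ] ℤ.+ χ) ℤ.* μ) ≡ (ι -[1+ 0 ] ℚ.+ ι χ) ℚ.* ι μ
  twisted χ μ = trans (ι-* (-[1+ 0 ] ℤ.+ χ) μ) (cong (ℚ._* ι μ) (ι-+ -[1+ 0 ] χ))
  ι-*-* : ∀ i j l → ι (i ℤ.* (j ℤ.* l)) ≡ ι i ℚ.* (ι j ℚ.* ι l)
  ι-*-* i j l = trans (ι-* i (j ℤ.* l)) (cong (ι i ℚ.*_) (ι-* j l))
  combination-in-atoms : μ-combination N ((k ℤ.- + 1) ℤ.* + p) (+ 3 ℤ.* ((+ 1 ℤ.- rem k 4) ℤ.* χ₄ p)) (+ 4 ℤ.* ((+ 1 ℤ.- rem k 3) ℤ.* χ₃ p))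
    ≡ u ℚ.* P ℚ.* M ℚ.+ ι (+ 3) ℚ.* (a₄ ℚ.* K₄) ℚ.* x ℚ.+ ι (+ 4) ℚ.* (a₃ ℚ.* K₃) ℚ.* y
  combination-in-atoms = cong₂ ℚ._+_
    (cong₂ ℚ._+_ (cong (ℚ._* M) (ι-* (k ℤ.- + 1) (+ p))) (cong (ℚ._* x) (ι-*-* (+ 3) (+ 1 ℤ.- rem k 4) (χ₄ p))))
    (cong (ℚ._* y) (ι-*-* (+ 4) (+ 1 ℤ.- rem k 3) (χ₃ p)))
  substitute : ∀ {α α′ β β′ γ γ′ δ δ′ X X′ Y Y′} → α ≡ α′ → β ≡ β′ → γ ≡ γ′ → δ ≡ δ′ → X ≡ X′ → Y ≡ Y′ →
    (α ℚ.* M ℚ.+ β ℚ.* x ℚ.+ γ ℚ.* y ℚ.- C) ℚ.+ (δ ℚ.* M ℚ.+ β ℚ.* X ℚ.+ γ ℚ.* Y) ≡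
    (α′ ℚ.* M ℚ.+ β′ ℚ.* x ℚ.+ γ′ ℚ.* y ℚ.- C) ℚ.+ (δ′ ℚ.* M ℚ.+ β′ ℚ.* X′ ℚ.+ γ′ ℚ.* Y′)
  substitute refl refl refl refl refl refl = refl
  collect : ∀ u P a₄ a₃ K₄ K₃ M x y C →
    (u ℚ.* c₁₂ ℚ.* M ℚ.+ a₄ ℚ.* c₄ ℚ.* x ℚ.+ a₃ ℚ.* c₃ ℚ.* y ℚ.- C)
      ℚ.+ (u ℚ.* (P ℚ.- ℚ.1ℚ) ℚ.* c₁₂ ℚ.* M ℚ.+ a₄ ℚ.* c₄ ℚ.* ((ι -[1+ 0 ] ℚ.+ K₄) ℚ.* x) ℚ.+ a₃ ℚ.* c₃ ℚ.* ((ι -[1+ 0 ] ℚ.+ K₃) ℚ.* y))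
    ≡ (u ℚ.* P ℚ.* M ℚ.+ ι (+ 3) ℚ.* (a₄ ℚ.* K₄) ℚ.* x ℚ.+ ι (+ 4) ℚ.* (a₃ ℚ.* K₃) ℚ.* y) ℚ.* c₁₂ ℚ.- C
  collect = RingSolver.solve-∀ ℚ-ring

μ-combination-+ : ∀ N x y z x′ y′ z′ →
  μ-combination N (x ℤ.+ x′) (y ℤ.+ y′) (z ℤ.+ z′) ≡ μ-combination N x y z ℚ.+ μ-combination N x′ y′ z′
μ-combination-+ N x y z x′ y′ z′ =
  trans (cong₂ ℚ._+_ (cong₂ ℚ._+_ (cong (ℚ._* μ₀ N) (ι-+ x x′)) (cong (ℚ._* ι (μ₀₂ N)) (ι-+ y y′))) (cong (ℚ._* ι (μ₀₃ N)) (ι-+ z z′)))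
    (distribute (ι x) (ι y) (ι z) (ι x′) (ι y′) (ι z′) (μ₀ N) (ι (μ₀₂ N)) (ι (μ₀₃ N)))
  where
  distribute : ∀ x y z x′ y′ z′ M a b →
    (x ℚ.+ x′) ℚ.* M ℚ.+ (y ℚ.+ y′) ℚ.* a ℚ.+ (z ℚ.+ z′) ℚ.* b ≡ (x ℚ.* M ℚ.+ y ℚ.* a ℚ.+ z ℚ.* b) ℚ.+ (x′ ℚ.* M ℚ.+ y′ ℚ.* a ℚ.+ z′ ℚ.* b)
  distribute = RingSolver.solve-∀ ℚ-ring

D+Dnew-shift : ∀ p N k t → D N (k ℤ.+ + t) ℚ.+ Dnew p N (k ℤ.+ + t) ≡
  (D N k ℚ.+ Dnew p N k) ℚ.+ μ-combination N (+ t ℤ.* + p)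
     (+ 3 ℤ.* (remDrop k (+ t) 4 ℤ.* χ₄ p)) (+ 4 ℤ.* (remDrop k (+ t) 3 ℤ.* χ₃ p)) ℚ.* (+ 1 / 12)
D+Dnew-shift p N k t = begin
  D N (k ℤ.+ + t) ℚ.+ Dnew p N (k ℤ.+ + t)
    ≡⟨ D+Dnew≡μ-combination p N (k ℤ.+ + t) ⟩
  μ-combination N ((k ℤ.+ + t ℤ.- + 1) ℤ.* + p) (+ 3 ℤ.* ((+ 1 ℤ.- rem (k ℤ.+ + t) 4) ℤ.* χ₄ p)) (+ 4 ℤ.* ((+ 1 ℤ.- rem (k ℤ.+ + t) 3) ℤ.* χ₃ p)) ℚ.* c₁₂ ℚ.- C
    ≡⟨ cong (λ w → w ℚ.* c₁₂ ℚ.- C) (trans (cong₃ (μ-combination N) (shift-weight k (+ t) (+ p))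
          (shift-remainder (+ 3) (rem k 4) (rem (k ℤ.+ + t) 4) (χ₄ p)) (shift-remainder (+ 4) (rem k 3) (rem (k ℤ.+ + t) 3) (χ₃ p)))
          (μ-combination-+ N X Y Z X′ Y′ Z′)) ⟩
  (μ-combination N X Y Z ℚ.+ μ-combination N X′ Y′ Z′) ℚ.* c₁₂ ℚ.- C
    ≡⟨ regroup (μ-combination N X Y Z) (μ-combination N X′ Y′ Z′) c₁₂ C ⟩
  (μ-combination N X Y Z ℚ.* c₁₂ ℚ.- C) ℚ.+ μ-combination N X′ Y′ Z′ ℚ.* c₁₂
    ≡⟨ cong (ℚ._+ μ-combination N X′ Y′ Z′ ℚ.* c₁₂) (D+Dnew≡μ-combination p N k) ⟨
  (D N k ℚ.+ Dnew p N k) ℚ.+ μ-combination N X′ Y′ Z′ ℚ.* c₁₂ ∎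
  where
  open ≡-Reasoning
  c₁₂ = + 1 / 12
  C = (+ c₀ N) / 2
  X = (k ℤ.- + 1) ℤ.* + p
  Y = + 3 ℤ.* ((+ 1 ℤ.- rem k 4) ℤ.* χ₄ p)
  Z = + 4 ℤ.* ((+ 1 ℤ.- rem k 3) ℤ.* χ₃ p)
  X′ = + t ℤ.* + p
  Y′ = + 3 ℤ.* (remDrop k (+ t) 4 ℤ.* χ₄ p)
  Z′ = + 4 ℤ.* (remDrop k (+ t) 3 ℤ.* χ₃ p)
  cong₃ : ∀ {A B C D : Set} (f : A → B → C → D) {a a′ b b′ c c′} → a ≡ a′ → b ≡ b′ → c ≡ c′ → f a b c ≡ f a′ b′ c′
  cong₃ f refl refl refl = refl
  shift-weight : ∀ k t p → (k ℤ.+ t ℤ.- + 1) ℤ.* p ≡ (k ℤ.- + 1) ℤ.* p ℤ.+ t ℤ.* p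
  shift-weight = ℤ-Solver.solve-∀
  shift-remainder : ∀ c ρ ρ′ χ → c ℤ.* ((+ 1 ℤ.- ρ′) ℤ.* χ) ≡ c ℤ.* ((+ 1 ℤ.- ρ) ℤ.* χ) ℤ.+ c ℤ.* ((ρ ℤ.- ρ′) ℤ.* χ)
  shift-remainder = ℤ-Solver.solve-∀
  regroup : ∀ w Δ c C → (w ℚ.+ Δ) ℚ.* c ℚ.- C ≡ (w ℚ.* c ℚ.- C) ℚ.+ Δ ℚ.* c
  regroup = RingSolver.solve-∀ ℚ-ring

nonNeg-combination : ∀ {α β a M : ℚ} → ℚ.0ℚ ℚ.≤ α → ℚ.0ℚ ℚ.≤ a → a ℚ.≤ M → ℚ.0ℚ ℚ.≤ α ℚ.+ β →
  ℚ.0ℚ ℚ.≤ α ℚ.* M ℚ.+ β ℚ.* a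
nonNeg-combination {α} {β} {a} {M} 0≤α 0≤a a≤M 0≤α+β = begin
  ℚ.0ℚ                  ≤⟨ 0≤* 0≤α+β 0≤a ⟩
  (α ℚ.+ β) ℚ.* a       ≡⟨ ℚP.*-distribʳ-+ a α β ⟩
  α ℚ.* a ℚ.+ β ℚ.* a   ≤⟨ ℚP.+-monoˡ-≤ (β ℚ.* a) (ℚP.*-monoˡ-≤-nonNeg α {{ℚ.nonNegative 0≤α}} a≤M) ⟩
  α ℚ.* M ℚ.+ β ℚ.* a   ∎
  where open ℚP.≤-Reasoning

-- A₂ μ₀ absorbs B μ₀₂ and A₃ μ₀ absorbs C μ₀₃, as 0 ≤ μ₀₂, μ₀₃ ≤ μ₀.
record WeightSplit (A B C : ℤ) : Set where
  field
    A₂ A₃   : ℤ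
    0≤A₂    : + 0 ℤ.≤ A₂
    0≤A₃    : + 0 ℤ.≤ A₃
    A₂+A₃≤A : A₂ ℤ.+ A₃ ℤ.≤ A
    0≤A₂+B  : + 0 ℤ.≤ A₂ ℤ.+ B
    0≤A₃+C  : + 0 ℤ.≤ A₃ ℤ.+ C

μ-combination-nonNeg : ∀ N → 1 ℕ.≤ N → ∀ {A B C} → WeightSplit A B C → ℚ.0ℚ ℚ.≤ μ-combination N A B C
μ-combination-nonNeg N 1≤N {A} {B} {C} split = begin
  ℚ.0ℚ
    ≤⟨ ℚP.+-mono-≤ (nonNeg-combination (ι-mono-≤ 0≤A₂) 0≤x x≤M (ι-+-nonNeg {A₂} {B} 0≤A₂+B))
                   (nonNeg-combination (ι-mono-≤ 0≤A₃) 0≤y y≤M (ι-+-nonNeg {A₃} {C} 0≤A₃+C)) ⟩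
  (ι A₂ ℚ.* M ℚ.+ ι B ℚ.* x) ℚ.+ (ι A₃ ℚ.* M ℚ.+ ι C ℚ.* y)
    ≡⟨ regroup (ι A₂) (ι A₃) (ι B) (ι C) M x y ⟩
  (ι A₂ ℚ.+ ι A₃) ℚ.* M ℚ.+ ι B ℚ.* x ℚ.+ ι C ℚ.* y
    ≡⟨ cong (λ w → w ℚ.* M ℚ.+ ι B ℚ.* x ℚ.+ ι C ℚ.* y) (ι-+ A₂ A₃) ⟨
  ι (A₂ ℤ.+ A₃) ℚ.* M ℚ.+ ι B ℚ.* x ℚ.+ ι C ℚ.* y
    ≤⟨ ℚP.+-monoˡ-≤ (ι C ℚ.* y) (ℚP.+-monoˡ-≤ (ι B ℚ.* x) (ℚP.*-monoʳ-≤-nonNeg M {{ℚ.nonNegative (μ₀-nonNeg N)}} (ι-mono-≤ A₂+A₃≤A))) ⟩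
  ι A ℚ.* M ℚ.+ ι B ℚ.* x ℚ.+ ι C ℚ.* y ∎
  where
  open WeightSplit split
  open ℚP.≤-Reasoning
  M = μ₀ N
  x = ι (μ₀₂ N)
  y = ι (μ₀₃ N)
  0≤x = proj₁ (μ₀₂-bounds N 1≤N)
  x≤M = proj₂ (μ₀₂-bounds N 1≤N)
  0≤y = proj₁ (μ₀₃-bounds N 1≤N)
  y≤M = proj₂ (μ₀₃-bounds N 1≤N)
  ι-+-nonNeg : ∀ {i j} → + 0 ℤ.≤ i ℤ.+ j → ℚ.0ℚ ℚ.≤ ι i ℚ.+ ι j
  ι-+-nonNeg {i} {j} 0≤i+j = subst (ℚ.0ℚ ℚ.≤_) (ι-+ i j) (ι-mono-≤ 0≤i+j)
  regroup : ∀ a₂ a₃ b c M x y → (a₂ ℚ.* M ℚ.+ b ℚ.* x) ℚ.+ (a₃ ℚ.* M ℚ.+ c ℚ.* y) ≡ (a₂ ℚ.+ a₃) ℚ.* M ℚ.+ b ℚ.* x ℚ.+ c ℚ.* y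
  regroup = RingSolver.solve-∀ ℚ-ring

scaled-nonNeg : ∀ c a {x} → ℤ.- a ℤ.≤ x → + 0 ℤ.≤ + c ℤ.* a ℤ.+ + c ℤ.* x
scaled-nonNeg c a {x} -a≤x = begin
  + 0                     ≡⟨ ℤP.*-zeroʳ (+ c) ⟨
  + c ℤ.* + 0             ≤⟨ ℤP.*-monoˡ-≤-nonNeg (+ c) (subst (ℤ._≤ a ℤ.+ x) (ℤP.+-inverseʳ a) (ℤP.+-monoʳ-≤ a -a≤x)) ⟩
  + c ℤ.* (a ℤ.+ x)       ≡⟨ ℤP.*-distribˡ-+ (+ c) a x ⟩
  + c ℤ.* a ℤ.+ + c ℤ.* x ∎
  where open ℤP.≤-Reasoning

*-zero-≥ : ∀ m x → ℤ.- + m ℤ.≤ x ℤ.* + 0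
*-zero-≥ m x = subst (ℤ.- + m ℤ.≤_) (sym (ℤP.*-zeroʳ x)) ℤP.neg-≤-pos

*-minusOne-≥ : ∀ {m x} → x ℤ.≤ + m → ℤ.- + m ℤ.≤ x ℤ.* -[1+ 0 ]
*-minusOne-≥ {m} {x} x≤m = subst (ℤ.- + m ℤ.≤_) (trans (sym (ℤP.-1*i≡-i x)) (ℤP.*-comm -[1+ 0 ] x)) (ℤP.neg-mono-≤ x≤m)

*-signValue-≥ : ∀ {K m x} → SignValue K → ℤ.- + m ℤ.≤ x → x ℤ.≤ + m → ℤ.- + m ℤ.≤ x ℤ.* K
*-signValue-≥ {m = m} {x} zero     _    _   = *-zero-≥ m x
*-signValue-≥ {m = m} {x} one      -m≤x _   = subst (ℤ.- + m ℤ.≤_) (sym (ℤP.*-identityʳ x)) -m≤x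
*-signValue-≥             minusOne _    x≤m = *-minusOne-≥ x≤m

-- For p = 2, 3 we have δ p = 2, and χ₄ p, χ₃ p are 0 and -1 in some order; for p ≥ 5 the
-- bounds |remDrop k t m| ≤ m - 1 give |B| ≤ 9 and |C| ≤ 8, against δ p · p ≥ 20.
step-weightSplit : ∀ p → Prime p → ∀ k →
  WeightSplit (+ δ p ℤ.* + p) (+ 3 ℤ.* (remDrop k (+ δ p) 4 ℤ.* χ₄ p))
                              (+ 4 ℤ.* (remDrop k (+ δ p) 3 ℤ.* χ₃ p))
step-weightSplit 0 p-prime = contradiction p-prime ¬prime[0]
step-weightSplit 1 p-prime = contradiction p-prime ¬prime[1]
step-weightSplit 2 _ k = record
  { A₂ = + 0 ; A₃ = + 4 ; 0≤A₂ = +≤+ ℕ.z≤n ; 0≤A₃ = +≤+ ℕ.z≤n ; A₂+A₃≤A = ℤP.≤-refl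
  ; 0≤A₂+B = scaled-nonNeg 3 (+ 0) (*-zero-≥ 0 (remDrop k (+ 2) 4))
  ; 0≤A₃+C = scaled-nonNeg 4 (+ 1) (*-minusOne-≥ (remDrop[2]≤ k 1))
  }
step-weightSplit 3 _ k = record
  { A₂ = + 6 ; A₃ = + 0 ; 0≤A₂ = +≤+ ℕ.z≤n ; 0≤A₃ = +≤+ ℕ.z≤n ; A₂+A₃≤A = ℤP.≤-refl
  ; 0≤A₂+B = scaled-nonNeg 3 (+ 2) (*-minusOne-≥ (remDrop[2]≤ k 2))
  ; 0≤A₃+C = scaled-nonNeg 4 (+ 0) (*-zero-≥ 0 (remDrop k (+ 2) 3))
  }
step-weightSplit 4 p-prime = contradiction composite[4] (prime⇒¬composite p-prime)
step-weightSplit p@(suc (suc (suc (suc (suc q))))) _ k = record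
  { A₂ = + 9 ; A₃ = + 8 ; 0≤A₂ = +≤+ ℕ.z≤n ; 0≤A₃ = +≤+ ℕ.z≤n ; A₂+A₃≤A = +≤+ 17≤δp*p
  ; 0≤A₂+B = scaled-nonNeg 3 (+ 3) (*-signValue-≥ (kronPrime-signValue (ℤ.- + 4) p) (proj₁ drop₄-bounds) (proj₂ drop₄-bounds))
  ; 0≤A₃+C = scaled-nonNeg 4 (+ 2) (*-signValue-≥ (kronPrime-signValue (ℤ.- + 3) p) (proj₁ drop₃-bounds) (proj₂ drop₃-bounds))
  }
  where
  drop₄-bounds = remDrop-bounds k (+ δ p) 3
  drop₃-bounds = remDrop-bounds k (+ δ p) 2
  17≤δp*p : 17 ℕ.≤ δ p ℕ.* p
  17≤δp*p = ℕP.≤-trans (ℕP.m≤m+n 17 3) (ℕP.*-mono-≤ (ℕP.m≤m+n 4 q) (ℕP.m≤m+n 5 q))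

D+Dnew-step-mono : ∀ p N → Prime p → 1 ℕ.≤ N → ∀ k →
  D N k ℚ.+ Dnew p N k ℚ.≤ D N (k ℤ.+ + δ p) ℚ.+ Dnew p N (k ℤ.+ + δ p)
D+Dnew-step-mono p N p-prime 1≤N k = begin
  S                ≡⟨ ℚP.+-identityʳ S ⟨
  S ℚ.+ ℚ.0ℚ       ≤⟨ ℚP.+-monoʳ-≤ S (0≤* (μ-combination-nonNeg N 1≤N (step-weightSplit p p-prime k)) (ℚ.*≤* (+≤+ ℕ.z≤n))) ⟩
  S ℚ.+ _          ≡⟨ D+Dnew-shift p N k (δ p) ⟨
  D N (k ℤ.+ + δ p) ℚ.+ Dnew p N (k ℤ.+ + δ p) ∎
  where
  open ℚP.≤-Reasoning
  S = D N k ℚ.+ Dnew p N k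

mono-from-successor : ∀ (f : ℤ → ℚ) → (∀ i → f i ℚ.≤ f (i ℤ.+ + 1)) → ∀ {m n} → m ℤ.≤ n → f m ℚ.≤ f n
mono-from-successor f step {m} {n} m≤n = subst (λ j → f m ℚ.≤ f j) m+[n-m]≡n (from-m ℤ.∣ n ℤ.- m ∣)
  where
  from-m : ∀ i → f m ℚ.≤ f (m ℤ.+ + i)
  from-m zero    = ℚP.≤-reflexive (cong f (sym (ℤP.+-identityʳ m)))
  from-m (suc i) = ℚP.≤-trans (from-m i)
    (subst (λ j → f (m ℤ.+ + i) ℚ.≤ f j) (trans (ℤP.+-assoc m (+ i) (+ 1)) (cong (λ j → m ℤ.+ + j) (ℕP.+-comm i 1))) (step (m ℤ.+ + i)))
  m+[n-m]≡n : m ℤ.+ + ℤ.∣ n ℤ.- m ∣ ≡ n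
  m+[n-m]≡n = trans (cong (λ j → m ℤ.+ j) (ℤP.0≤i⇒+∣i∣≡i (ℤP.i≤j⇒0≤j-i m≤n))) (telescope m n)
    where
    telescope : ∀ m n → m ℤ.+ (n ℤ.- m) ≡ n
    telescope = ℤ-Solver.solve-∀

kₙ-suc : ∀ p k₀ i → kₙ p k₀ (i ℤ.+ + 1) ≡ kₙ p k₀ i ℤ.+ + δ p
kₙ-suc p k₀ i = shift (+ k₀) i (+ δ p)
  where
  shift : ∀ k₀ i δ → k₀ ℤ.+ (i ℤ.+ + 1) ℤ.* δ ≡ (k₀ ℤ.+ i ℤ.* δ) ℤ.+ δ
  shift = ℤ-Solver.solve-∀

proposition5p3 : (p N k₀ : ℕ) → Prime p → 1 ℕ.≤ N → ¬ (p ∣ N)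
  → 2 ∣ k₀ → 2 ℕ.≤ k₀ → k₀ ℕ.< p ℕ.+ 1
  → (m n : ℤ) → m ℤ.≤ n
  → d p N k₀ m ℚ.+ dnew p N k₀ m ℚ.≤ d p N k₀ n ℚ.+ dnew p N k₀ n
proposition5p3 p N k₀ p-prime 1≤N _ _ _ _ m n m≤n = mono-from-successor (λ i → d p N k₀ i ℚ.+ dnew p N k₀ i) step m≤n
  where
  step : ∀ i → d p N k₀ i ℚ.+ dnew p N k₀ i ℚ.≤ d p N k₀ (i ℤ.+ + 1) ℚ.+ dnew p N k₀ (i ℤ.+ + 1)
  step i = subst (λ k → D N (kₙ p k₀ i) ℚ.+ Dnew p N (kₙ p k₀ i) ℚ.≤ D N k ℚ.+ Dnew p N k) (sym (kₙ-suc p k₀ i))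
             (D+Dnew-step-mono p N p-prime 1≤N (kₙ p k₀ i))
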